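{- Let $G$ be any connected graph and let $U\subseteq V(G)$ be any vertex set. Then exactly one of the following two assertions holds: (i) $G$ contains a comb attached to $U$; (ii) $G$ has a rayless tree-decomposition into parts each containing at most finitely many vertices from $U$ and whose parts at non-leaves of the decomposition tree are all finite. Moreover, the rayless tree-decomposition in (ii) displays $\partial_\Omega U$ and may be chosen with connected separators.
   Context: Graphs may be infinite. A ray is a one-way infinite path. A comb is the union of a ray $R$ (its spine) with infinitely many disjoint finite paths, possibly trivial, that have precisely their first vertex on $R$; the last vertices of these paths are its teeth. A comb attached to $U$ is a comb all of whose teeth lie in $U$. A tree-decomposition $(T,\mathcal V)$ of $G$, with $\mathcal V=(V_t)_{t\in T}$, is a (possibly infinite) tree $T$ with parts $V_t\subseteq V(G)$ such that $\bigcup_t V_t=V(G)$, every edge of $G$ has both ends in some part, and $V_{t_1}\cap V_{t_3}\subseteq V_{t_2}$ whenever $t_2$ lies on the path $t_1Tt_3$. It is rayless if $T$ contains no ray. Its separators (adhesion sets) are the sets $V_x\cap V_y$ for edges $xy$ of $T$; a separator $X$ is connected if $G[X]$ is connected. An end of $G$ is an equivalence class of rays, two rays being equivalent if for every finite $X\subseteq V(G)$ they have tails in the same component of $G-X$; $C(X,\omega)$ is the component of $G-X$ containing a tail of every ray of the end $\omega$. $\Omega(G)$ is the set of ends of $G$. $\partial_\Omega U$ is the set of ends $\omega$ of $G$ in the closure of $U$, i.e. such that $C(X,\omega)$ meets $U$ for every finite $X\subseteq V(G)$. Display: let $(T,\mathcal V)$ be a tree-decomposition with finite separators. For an edge $xy$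 of $T$ let $T_x,T_y$ be the components of $T-xy$ containing $x$ and $y$, and let $A=\bigcup_{t\in T_x}V_t$, $B=\bigcup_{t\in T_y}V_t$. An end $\omega$ of $G$ orients $xy$ towards $y$ if its rays have tails in $G[B]$ that avoid $A$, and towards $x$ in the symmetric case. Then $\omega$ either lives at a unique node $t$ (all edges at $t$ are oriented towards $t$) or corresponds to a unique end $\eta$ of $T$ (for a ray $t_1t_2\dots\in\eta$ every edge $t_nt_{n+1}$ is oriented towards $t_{n+1}$). This defines $\tau\colon\Omega(G)\to\Omega(T)\sqcup V(T)$. $(T,\mathcal V)$ displays $\Psi\subseteq\Omega(G)$ if $\tau$ restricts to a bijection $\Psi\to\Omega(T)$ and maps every end of $G$ not in $\Psi$ to a node of $T$. -}

module Defs where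

open import Level using (Level; suc)
open import Data.List.Base using (List; []; _∷_; length)
open import Data.List.Membership.Propositional using (_∈_; _∉_)
open import Data.List.Relation.Unary.Unique.Propositional using (Unique)
open import Data.Nat.Base using (ℕ; _+_; _≤_)
import Data.Nat.Base as ℕ
open import Data.Product.Base using (Σ; ∃; ∃₂; Σ-syntax; ∃-syntax; _×_; _,_; proj₁; proj₂)
open import Data.Sum.Base using (_⊎_; inj₁; inj₂; [_,_]′)
open import Data.Sum.Relation.Binary.Pointwise using (Pointwise)
open import Function.Base using (_on_)
open import Function.Bundles using (_⇔_)
open import Function.Definitions using (Injective; Congruent; Bijective)
open import Relation.Binary.Core using (Rel)
open import Relation.Binary.Definitions using (Symmetric)
open import Relation.Binary.Construct.Closure.ReflexiveTransitive using (Star; ε; _◅_)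
open import Relation.Binary.PropositionalEquality.Core using (_≡_)
open import Relation.Nullary.Negation.Core using (¬_)
open import Relation.Unary using (Pred; _⊆_; _∩_; _≬_; Satisfiable)

private
  variable
    a b ℓ : Level

ExactlyOneOf : Set a → Set b → Set _
ExactlyOneOf P Q = (P × ¬ Q) ⊎ (¬ P × Q)

-- A set is finite if some list covers it.  Individual finite sets of vertices
-- (such as the sets X deleted in the definition of ends) are given as lists.
Finite : {A : Set a} → Pred A ℓ → Set _
Finite P = ∃[ xs ] P ⊆ (_∈ xs)

record Graph ℓ : Set (suc ℓ) where
  field
    V      : Set ℓ
    _~_    : Rel V ℓ
    ~-sym  : Symmetric _~_
    irrefl : ∀ {v} → ¬ (v ~ v)

open Graph using (V)

module _ (G : Graph ℓ) where
  open Graph G using (_~_)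

  ----------------------------------------------------------------------
  -- Walks, paths, connectedness.  A walk is a term of Star _~_.

  vertices : ∀ {u v} → Star _~_ u v → List (V G)
  vertices {u} ε       = u ∷ []
  vertices {u} (_ ◅ w) = u ∷ vertices w

  Path : Rel (V G) ℓ
  Path u v = Σ[ w ∈ Star _~_ u v ] Unique (vertices w)

  pathVertices : ∀ {u v} → Path u v → List (V G)
  pathVertices p = vertices (proj₁ p)

  -- Connected graphs are nonempty.
  Connected : Set ℓ
  Connected = V G × (∀ u v → Star _~_ u v)

  -- The edge relation of the induced subgraph G[A].
  Induced : Pred (V G) ℓ → Rel (V G) ℓ
  Induced A u v = A u × A v × u ~ v

  -- u and v are vertices of the same component of G[A].
  SameComponent : Pred (V G) ℓ → Rel (V G) ℓ
  SameComponent A u v = A u × A v × Star (Induced A) u v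

  -- G[A] is connected.
  ConnectedSet : Pred (V G) ℓ → Set ℓ
  ConnectedSet A = Satisfiable A × (∀ {u v} → A u → A v → SameComponent A u v)

  -- The edge relation of G − xy.
  DeleteEdge : (x y : V G) → Rel (V G) ℓ
  DeleteEdge x y u v = u ~ v × ¬ (u ≡ x × v ≡ y) × ¬ (u ≡ y × v ≡ x)

  ----------------------------------------------------------------------
  -- Trees

  -- A cycle is a path on at least three vertices plus an edge joining its ends.
  Acyclic : Set ℓ
  Acyclic = ¬ (∃₂ λ u v → Σ[ p ∈ Path u v ] 3 ≤ length (pathVertices p) × v ~ u)

  IsTree : Set ℓ
  IsTree = Connected × Acyclic

  Leaf : Pred (V G) ℓ
  Leaf t = ∃[ s ] t ~ s × (∀ s′ → t ~ s′ → s′ ≡ s)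

  ----------------------------------------------------------------------
  -- Rays and combs

  record Ray : Set ℓ where
    field
      at        : ℕ → V G
      injective : Injective _≡_ _≡_ at
      adjacent  : ∀ n → at n ~ at (ℕ.suc n)

  open Ray using (at)

  Rayless : Set ℓ
  Rayless = ¬ Ray

  -- The disjoint paths are indexed by ℕ: being disjoint and having their first
  -- vertices on a ray, there are only countably many.
  record Comb : Set ℓ where
    field
      spine    : Ray
      first    : ℕ → V G
      tooth    : ℕ → V G
      path     : ∀ i → Path (first i) (tooth i)
      disjoint : ∀ {i j v} → v ∈ pathVertices (path i) → v ∈ pathVertices (path j) → i ≡ j
      meets    : ∀ i {v} → v ∈ pathVertices (path i) → (∃[ n ] at spine n ≡ v) ⇔ v ≡ first i

  AttachedTo : Pred (V G) ℓ → Pred Comb ℓ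
  AttachedTo U C = ∀ i → U (Comb.tooth C i)

  ----------------------------------------------------------------------
  -- Ends.  An end is represented by any of its rays, so that Ω(G) is Ray
  -- taken up to _≈_, and a set of ends is a predicate on rays.

  _≈_ : Rel Ray ℓ
  R ≈ S = ∀ (X : List (V G)) → ∃₂ λ m n →
          ∀ i j → SameComponent (_∉ X) (at R (m + i)) (at S (n + j))

  -- C(X , ω), the component of G − X that contains a tail of every ray of ω.
  C : List (V G) → Ray → Pred (V G) ℓ
  C X ω v = ∀ R → R ≈ ω → ∃[ n ] (∀ i → SameComponent (_∉ X) (at R (n + i)) v)

  ∂Ω : Pred (V G) ℓ → Pred Ray ℓ
  ∂Ω U ω = ∀ X → C X ω ≬ U

------------------------------------------------------------------------
-- Tree-decompositions

record TreeDecomposition (G : Graph ℓ) : Set (suc ℓ) where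
  open Graph G using (_~_)
  field
    T         : Graph ℓ
    isTree    : IsTree T
    part      : V T → Pred (V G) ℓ
    covers    : ∀ v → ∃[ t ] part t v
    edges     : ∀ {u v} → u ~ v → ∃[ t ] part t u × part t v
    coherence : ∀ {t₁ t₂ t₃} (p : Path T t₁ t₃) → t₂ ∈ pathVertices T p →
                part t₁ ∩ part t₃ ⊆ part t₂

open Ray using (at)

module _ {G : Graph ℓ} (D : TreeDecomposition G) where
  open TreeDecomposition D
  open Graph T using () renaming (_~_ to _~ᵀ_)

  FiniteSeparators : Set ℓ
  FiniteSeparators = ∀ {x y} → x ~ᵀ y → Finite (part x ∩ part y)

  ConnectedSeparators : Set ℓ
  ConnectedSeparators = ∀ {x y} → x ~ᵀ y → ConnectedSet G (part x ∩ part y)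

  RaylessWithFiniteParts : Pred (V G) ℓ → Set ℓ
  RaylessWithFiniteParts U =
      Rayless T
    × (∀ t → Finite (part t ∩ U))
    × (∀ t → ¬ Leaf T t → Finite (part t))

  -- The union of the parts V_t with t in the component of T − xy containing x.
  Side : (x y : V T) → Pred (V G) ℓ
  Side x y v = ∃[ t ] Star (DeleteEdge T x y) x t × part t v

  -- ω orients the edge xy towards y.
  Orients : Ray G → (x y : V T) → Set ℓ
  Orients ω x y = ∀ R → _≈_ G R ω →
    ∃[ n ] (∀ i → Side y x (at R (n + i)) × ¬ Side x y (at R (n + i)))

  LivesAt : Ray G → V T → Set ℓ
  LivesAt ω t = ∀ s → s ~ᵀ t → Orients ω s t

  CorrespondsTo : Ray G → Ray T → Set ℓ
  CorrespondsTo ω η = ∀ R → _≈_ T R η → ∀ n → Orients ω (at R n) (at R (ℕ.suc n))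

  -- Ω(T) is the left summand of the codomain of τ; the restriction of τ to Ψ
  -- is recorded as a map τΨ into Ω(T).
  record Displays (Ψ : Pred (Ray G) ℓ) : Set ℓ where
    field
      finiteSeparators : FiniteSeparators
      τ                : Ray G → Ray T ⊎ V T
      τ-cong           : Congruent (_≈_ G) (Pointwise (_≈_ T) _≡_) τ
      τ-correct        : ∀ ω → [ CorrespondsTo ω , LivesAt ω ]′ (τ ω)
      τΨ               : ∃ Ψ → Ray T
      τΨ-restricts     : ∀ ω (ω∈Ψ : Ψ ω) → τ ω ≡ inj₁ (τΨ (ω , ω∈Ψ))
      τΨ-bijective     : Bijective (_≈_ G on proj₁) (_≈_ T) τΨ
      τ-outside        : ∀ ω → ¬ Ψ ω → ∃[ t ] τ ω ≡ inj₂ t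

module Submission where

-- For a tree-decomposition with finite separators every end orients every edge of T.  If T is
-- rayless, then following the orientation stops, so every end lives at a node; the part there is
-- infinite, hence the node is a leaf, and its finitely many vertices of U cannot keep the end in
-- the closure of U.  So ∂Ω U is empty, as is Ω(T), and there is no comb attached to U.
--
-- For the converse, explore G depth first: a region D with a centre c ∈ D is cut into the
-- components of G[D] − c, and each component gets as its centre a neighbour of c from which U can
-- be reached, inside the component, by a shortest path.  Stop at regions that avoid U.  An infinite
-- branch is a ray of centres c₀ c₁ …; whenever the distance to U does not drop from cᵢ to cᵢ₊₁, the
-- shortest path from cᵢ to U misses the next region.  This happens infinitely often, and these
-- paths form a comb.  Hence without a comb the exploration tree is rayless and contains U, and the
-- chains of centres above its nodes, together with the components left over, are the parts.

open import Defs
open import Level using (Level; Lift; lift)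
open import Axiom.ExcludedMiddle using (ExcludedMiddle)
open import Axiom.Extensionality.Propositional using (Extensionality)
open import Data.Bool.Base using (Bool; true; false)
open import Data.Empty using (⊥-elim)
open import Data.List.Base using (List; []; _∷_; _++_; length; map; upTo)
open import Data.List.Membership.Propositional using (_∈_; _∉_)
open import Data.List.Membership.Propositional.Properties
  using (∈-map⁺; ∈-upTo⁺; ∈-++⁺ˡ; ∈-++⁺ʳ)
open import Data.List.Relation.Unary.All as All using (All; []; _∷_)
import Data.List.Relation.Unary.All.Properties as All
open import Data.List.Relation.Unary.Any using (here; there)
open import Data.List.Relation.Unary.AllPairs using ([]; _∷_)
open import Data.List.Relation.Unary.Unique.Propositional using (Unique)
open import Data.Nat.Base using (ℕ; zero; suc; _+_; _≤_; _<_; z≤n; s≤s; _∸_)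
open import Data.Nat.Properties
open import Data.Product.Base using (∃; ∃₂; Σ-syntax; ∃-syntax; _×_; _,_; proj₁; proj₂)
open import Data.Sum.Base using (_⊎_; inj₁; inj₂; [_,_]′; swap)
open import Data.Sum.Relation.Binary.Pointwise using (inj₁; inj₂)
open import Function.Base using (_∘_; id)
open import Function.Bundles using (_⇔_; mk⇔; Equivalence)
open import Relation.Binary.Core using (Rel; _⇒_)
open import Relation.Binary.Definitions using (tri<; tri≈; tri>)
open import Relation.Binary.Construct.Closure.ReflexiveTransitive
  using (Star; ε; _◅_; _◅◅_; reverse)
  renaming (map to map⋆)
open import Relation.Binary.PropositionalEquality
  using (_≡_; _≢_; refl; sym; trans; cong; subst; subst₂)
open import Relation.Nullary using (¬_; Dec; yes; no)
open import Relation.Nullary.Decidable using (decidable-stable)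
open import Relation.Unary using (Pred; _⊆_; _∩_)

private
  variable
    a b ℓ : Level

-- Minima and descent in the natural numbers

least : (∀ {a} → ExcludedMiddle a) → (P : ℕ → Set a) → ∀ n → P n →
  ∃[ k ] P k × (∀ j → P j → k ≤ j)
least em P zero    p = zero , p , λ _ _ → z≤n
least em P (suc n) p with em {P = P 0}
... | yes p₀ = 0 , p₀ , λ _ _ → z≤n
... | no ¬p₀ = let (k , pk , min) = least em (P ∘ suc) n p in
  suc k , pk , λ { zero p₀ → ⊥-elim (¬p₀ p₀) ; (suc j) pj → s≤s (min j pj) }

-- Every step costs at least one, so `f i + i` stays below `f 0`; this fails at `i = suc (f 0)`.
no-descent : (f : ℕ → ℕ) → ¬ (∀ i → f (suc i) < f i)
no-descent f dec = <-irrefl refl (≤-trans (m≤n+m _ (f (suc (f 0)))) (bound (suc (f 0))))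
  where
  bound : ∀ i → f i + i ≤ f 0
  bound zero    = ≤-reflexive (+-identityʳ _)
  bound (suc i) = ≤-trans (≤-reflexive (+-suc _ i)) (≤-trans (+-monoˡ-≤ i (dec i)) (bound i))

-- Walks, rays and finite vertex sets

module Walks (G : Graph ℓ) where
  open Graph G

  start∈ : ∀ {u v} (w : Star _~_ u v) → u ∈ vertices G w
  start∈ ε       = here refl
  start∈ (_ ◅ _) = here refl

  end∈ : ∀ {u v} (w : Star _~_ u v) → v ∈ vertices G w
  end∈ ε       = here refl
  end∈ (_ ◅ w) = there (end∈ w)

  closed-path : ∀ {v} (w : Star _~_ v v) → Unique (vertices G w) → vertices G w ≡ v ∷ []
  closed-path ε       _        = refl
  closed-path (_ ◅ w) (v∉ ∷ _) = ⊥-elim (All.lookup v∉ (end∈ w) refl)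

  module _ {A : Pred V ℓ} where

    step⁻ : ∀ {u v} → Induced G A u v → Induced G A v u
    step⁻ (au , av , e) = av , au , ~-sym e

    sc-refl : ∀ {u} → A u → SameComponent G A u u
    sc-refl au = au , au , ε

    sc-sym : ∀ {u v} → SameComponent G A u v → SameComponent G A v u
    sc-sym (au , av , w) = av , au , reverse step⁻ w

    sc-trans : ∀ {u v w} → SameComponent G A u v → SameComponent G A v w → SameComponent G A u w
    sc-trans (au , _ , w) (_ , aw , w′) = au , aw , w ◅◅ w′

    sc-step : ∀ {u v} → A u → A v → u ~ v → SameComponent G A u v
    sc-step au av e = au , av , (au , av , e) ◅ ε

    walk-component : ∀ {u v x} (w : Star _~_ u v) → All A (vertices G w) →
                     x ∈ vertices G w → SameComponent G A u x
    walk-component ε       (au ∷ _) (here refl) = sc-refl au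
    walk-component (e ◅ w) (au ∷ _) (here refl) = sc-refl au
    walk-component (e ◅ w) (au ∷ as) (there x∈) =
      sc-trans (sc-step au (All.lookup as (start∈ w)) e) (walk-component w as x∈)

    component-walk : ∀ {u v x} → SameComponent G A x u → Star (Induced G A) u v →
                     Star (Induced G (SameComponent G A x)) u v
    component-walk xu ε = ε
    component-walk xu (e@(au , ay , _) ◅ w) =
      let xy = sc-trans xu (au , ay , e ◅ ε) in (xu , xy , proj₂ (proj₂ e)) ◅ component-walk xy w

    induced-vertices : ∀ {u v} → A u → (w : Star (Induced G A) u v) →
                       All A (vertices G (map⋆ (proj₂ ∘ proj₂) w))
    induced-vertices au ε                   = au ∷ []
    induced-vertices au ((_ , ax , _) ◅ w) = au ∷ induced-vertices ax w

  module _ (em : ∀ {a} → ExcludedMiddle a) where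

    module _ {_⟶_ : Rel V ℓ} (f : _⟶_ ⇒ _~_) where

      -- Working in a subrelation `_⟶_` of adjacency lets the resulting path keep what the walk
      -- knew, such as staying in an induced subgraph or avoiding a deleted edge.
      shorten : ∀ {u v x} (w : Star _⟶_ u v) → Unique (vertices G (map⋆ f w)) →
                x ∈ vertices G (map⋆ f w) → Σ[ w′ ∈ Star _⟶_ x v ] Unique (vertices G (map⋆ f w′))
      shorten ε       uq       (here refl) = ε , uq
      shorten (e ◅ w) uq       (here refl) = e ◅ w , uq
      shorten (e ◅ w) (_ ∷ uq) (there x∈)  = shorten w uq x∈

      walk⇒path : ∀ {u v} → Star _⟶_ u v → Σ[ w ∈ Star _⟶_ u v ] Unique (vertices G (map⋆ f w))
      walk⇒path ε = ε , [] ∷ []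
      walk⇒path {u} (e ◅ w) with walk⇒path w
      ... | w′ , uq with em {P = u ∈ vertices G (map⋆ f w′)}
      ...   | yes u∈ = shorten w′ uq u∈
      ...   | no u∉  = e ◅ w′ , All.¬Any⇒All¬ _ u∉ ∷ uq

    crossing : (P : Pred V a) → ∀ {s t} (w : Star _~_ s t) → P s → ¬ P t →
      ∃₂ λ x y → x ∈ vertices G w × y ∈ vertices G w × x ~ y × P x × ¬ P y
    crossing P ε ps ¬pt = ⊥-elim (¬pt ps)
    crossing P {s} (_◅_ {j = x} e w) ps ¬pt with em {P = P x}
    ... | no ¬px = s , x , here refl , there (start∈ w) , e , ps , ¬px
    ... | yes px = let (x , y , x∈ , y∈ , rest) = crossing P w px ¬pt in
      x , y , there x∈ , there y∈ , rest

    -- A path cannot leave P and come back, since both passages would use the gate.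
    path-stays : (P : Pred V a) (g : V) → (∀ {x y} → x ~ y → ¬ P x → P y → y ≡ g) →
      ∀ {s t x} (w : Star _~_ s t) → Unique (vertices G w) → P s → P t → x ∈ vertices G w → P x
    path-stays P g gate ε       _ ps _ (here refl) = ps
    path-stays P g gate (_ ◅ _) _ ps _ (here refl) = ps
    path-stays P g gate (_◅_ {j = y} e w) (s∉ ∷ uq) ps pt (there x∈) with em {P = P y}
    ... | yes py = path-stays P g gate w uq py pt x∈
    ... | no ¬py with crossing (λ z → ¬ P z) w ¬py (λ ¬pt → ¬pt pt)
    ...   | x′ , y′ , _ , y′∈ , e′ , ¬px′ , ¬¬py′ = ⊥-elim (All.lookup s∉ y′∈
          (trans (gate (~-sym e) ¬py ps) (sym (gate e′ ¬px′ (decidable-stable em ¬¬py′)))))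

    -- Each vertex of `X` lies in at most one of the disjoint sets. This serves both rays, as
    -- sequences of singletons, and the paths of a comb.
    eventually-avoids : (P : ℕ → Pred V a) → (∀ {i j v} → P i v → P j v → i ≡ j) → ∀ X →
      ∃[ N ] (∀ i → N ≤ i → ∀ {v} → P i v → v ∉ X)
    eventually-avoids P dis [] = 0 , λ _ _ _ ()
    eventually-avoids P dis (x ∷ X) with eventually-avoids P dis X | em {P = ∃[ i ] P i x}
    ... | N , out | no ¬p = N , λ where
      i N≤i p (here refl) → ¬p (i , p)
      i N≤i p (there v∈)  → out i N≤i p v∈
    ... | N , out | yes (i₀ , p₀) = suc i₀ + N , λ where
      i N≤i p (here refl) → <⇒≢ (≤-trans (m≤m+n _ _) N≤i) (dis p₀ p)
      i N≤i p (there v∈)  → out i (≤-trans (m≤n+m N (suc i₀)) N≤i) p v∈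

    ray-avoids : (R : Ray G) → ∀ X → ∃[ N ] (∀ i → N ≤ i → Ray.at R i ∉ X)
    ray-avoids R X =
      let (N , out) = eventually-avoids (λ i v → Ray.at R i ≡ v)
                        (λ p q → Ray.injective R (trans p (sym q))) X
      in N , λ i N≤i → out i N≤i refl

    tail-component : (R : Ray G) → ∀ {X N} → (∀ i → N ≤ i → Ray.at R i ∉ X) →
      ∀ i j → N ≤ i → N ≤ j → SameComponent G (_∉ X) (Ray.at R i) (Ray.at R j)
    tail-component R {X} {N} out i j N≤i N≤j = sc-trans (sc-sym (from i N≤i)) (from j N≤j)
      where
      go : ∀ k → SameComponent G (_∉ X) (Ray.at R N) (Ray.at R (k + N))
      go zero    = sc-refl (out N ≤-refl)
      go (suc k) = sc-trans (go k)
        (sc-step (out _ (m≤n+m N k)) (out _ (m≤n+m N (suc k))) (Ray.adjacent R (k + N)))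
      from : ∀ i → N ≤ i → SameComponent G (_∉ X) (Ray.at R N) (Ray.at R i)
      from i N≤i = subst (λ k → SameComponent G _ (Ray.at R N) (Ray.at R k)) (m∸n+n≡m N≤i) (go _)

    ≈-refl : ∀ R → _≈_ G R R
    ≈-refl R X = let (N , out) = ray-avoids R X in
      N , N , λ i j → tail-component R out (N + i) (N + j) (m≤m+n N i) (m≤m+n N j)

    ≈-sym : ∀ R S → _≈_ G R S → _≈_ G S R
    ≈-sym R S R≈S X = let (m , n , s) = R≈S X in n , m , λ i j → sc-sym (s j i)

    ≈-trans : ∀ R S Q → _≈_ G R S → _≈_ G S Q → _≈_ G R Q
    ≈-trans R S Q R≈S S≈Q X with R≈S X | S≈Q X
    ... | m , n , s | m′ , n′ , s′ = m , n′ , λ i j →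
      -- Both tails of `S` contain its vertex with index `n + m′`, which links the two components.
      sc-trans (s i m′) (subst (λ k → SameComponent G (_∉ X) (Ray.at S k) (Ray.at Q (n′ + j)))
        (+-comm m′ n) (s′ n j))

-- Sets as Boolean functions

module Characteristic (em : ∀ {a} → ExcludedMiddle a) (ext : ∀ {a b} → Extensionality a b) where

  -- Equivalent predicates become equal functions, so that anything chosen from a set depends on the
  -- set alone and not on how it is presented.
  χ : {A : Set a} → Pred A ℓ → A → Lift ℓ Bool
  χ P x with em {P = P x}
  ... | yes _ = lift true
  ... | no  _ = lift false

  χ⁺ : {A : Set a} (P : Pred A ℓ) {x : A} → P x → χ P x ≡ lift true
  χ⁺ P {x} p with em {P = P x}
  ... | yes _ = refl
  ... | no ¬p = ⊥-elim (¬p p)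

  χ⁻ : {A : Set a} (P : Pred A ℓ) {x : A} → χ P x ≡ lift true → P x
  χ⁻ P {x} eq with em {P = P x}
  χ⁻ P {x} eq | yes p = p
  χ⁻ P {x} () | no _

  χ-cong : {A : Set a} (P Q : Pred A ℓ) → P ⊆ Q → Q ⊆ P → χ P ≡ χ Q
  χ-cong P Q P⊆Q Q⊆P = ext λ x → pointwise x
    where
    pointwise : ∀ x → χ P x ≡ χ Q x
    pointwise x with em {P = P x} | em {P = Q x}
    ... | yes _ | yes _ = refl
    ... | no _  | no _  = refl
    ... | yes p | no ¬q = ⊥-elim (¬q (P⊆Q p))
    ... | no ¬p | yes q = ⊥-elim (¬p (Q⊆P q))

-- Ends in rayless tree-decompositions

module Decomposition (em : ∀ {a} → ExcludedMiddle a) {G : Graph ℓ} (D : TreeDecomposition G) where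
  open Graph G
  open TreeDecomposition D
  open Graph T using () renaming (V to Vᵀ; _~_ to _~ᵀ_; ~-sym to ~ᵀ-sym; irrefl to irreflᵀ)
  open Walks
  open Ray

  -- The component of T - xy that contains `x`.
  Reach : (x y : Vᵀ) → Pred Vᵀ ℓ
  Reach x y t = Star (DeleteEdge T x y) x t

  delete-swap : ∀ {x y} → DeleteEdge T x y ⇒ DeleteEdge T y x
  delete-swap (e , p , q) = e , q , p

  delete-sym : ∀ {x y s t} → DeleteEdge T x y s t → DeleteEdge T x y t s
  delete-sym (e , p , q) = ~ᵀ-sym e , (λ (a , b) → q (b , a)) , (λ (a , b) → p (b , a))

  reach-total : ∀ {x y} → x ~ᵀ y → ∀ t → Reach x y t ⊎ Reach y x t
  reach-total {x} {y} e t = go (proj₂ (proj₁ isTree) t x)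
    where
    go : ∀ {t} → Star _~ᵀ_ t x → Reach x y t ⊎ Reach y x t
    go ε = inj₁ ε
    go (_◅_ {i = t} {j = t′} d w) with em {P = x ≡ t} | em {P = y ≡ t}
    ... | yes refl | _        = inj₁ ε
    ... | no _     | yes refl = inj₂ ε
    ... | no x≢t   | no y≢t   with go w
    ...   | inj₁ r = inj₁ (r ◅◅ (~ᵀ-sym d , (λ (_ , q) → y≢t (sym q)) , (λ (_ , q) → x≢t (sym q))) ◅ ε)
    ...   | inj₂ r = inj₂ (r ◅◅ (~ᵀ-sym d , (λ (_ , q) → x≢t (sym q)) , (λ (_ , q) → y≢t (sym q))) ◅ ε)

  -- A path from `x` to `y` that avoids the edge xy has at least three vertices, so the edge closes
  -- it to a cycle.
  edge-not-bypassed : ∀ {x y} → x ~ᵀ y → ¬ Reach x y y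
  edge-not-bypassed e r with walk⇒path T em proj₁ r
  ... | ε , _           = irreflᵀ e
  ... | d ◅ ε , _       = proj₁ (proj₂ d) (refl , refl)
  ... | p@(_ ◅ _ ◅ w) , uq =
    proj₂ isTree (_ , _ , (map⋆ proj₁ p , uq) , s≤s (s≤s (nonempty w)) , ~ᵀ-sym e)
    where
    nonempty : ∀ {x y s t} (w : Star (DeleteEdge T x y) s t) →
               1 ≤ length (vertices T (map⋆ proj₁ w))
    nonempty ε       = s≤s z≤n
    nonempty (_ ◅ _) = s≤s z≤n

  reach-disjoint : ∀ {x y t} → x ~ᵀ y → Reach x y t → ¬ Reach y x t
  reach-disjoint e r r′ = edge-not-bypassed e (r ◅◅ reverse delete-sym (map⋆ delete-swap r′))

  -- A walk between the two components of T − xy uses the edge xy.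
  side-∩ : ∀ {x y v} → x ~ᵀ y → Side D x y v → Side D y x v → (part x ∩ part y) v
  side-∩ {x} {y} {v} e (t , r , vt) (t′ , r′ , vt′)
    with walk⇒path T em id (proj₂ (proj₁ isTree) t t′)
  ... | w , uq with crossing T em (Reach x y) (map⋆ id w) r (λ r″ → reach-disjoint e r″ r′)
  ...   | a , b , a∈ , b∈ , ab , ra , ¬rb with em {P = a ≡ x × b ≡ y} | em {P = a ≡ y × b ≡ x}
  ...     | yes (refl , refl) | _ =
            coherence (map⋆ id w , uq) a∈ (vt , vt′) , coherence (map⋆ id w , uq) b∈ (vt , vt′)
  ...     | no _ | yes (refl , refl) = ⊥-elim (¬rb ε)
  ...     | no p | no q = ⊥-elim (¬rb (ra ◅◅ (ab , p , q) ◅ ε))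

  side-total : ∀ {x y} → x ~ᵀ y → ∀ v → Side D x y v ⊎ Side D y x v
  side-total e v with covers v
  ... | t , vt with reach-total e t
  ...   | inj₁ r = inj₁ (t , r , vt)
  ...   | inj₂ r = inj₂ (t , r , vt)

  -- Some part contains both ends of the edge. Were it on the other side, `u` would lie on both
  -- sides, hence in the separator.
  side-step : ∀ {x y u v} → x ~ᵀ y → ¬ (part x ∩ part y) u → u ~ v → Side D x y u → Side D x y v
  side-step e u∉ uv su with edges uv
  ... | t , ut , vt with reach-total e t
  ...   | inj₁ r = t , r , vt
  ...   | inj₂ r = ⊥-elim (u∉ (side-∩ e su (t , r , ut)))

  side-component : ∀ {x y u v X} → x ~ᵀ y → part x ∩ part y ⊆ (_∈ X) →
                   SameComponent G (_∉ X) u v → Side D x y u → Side D x y v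
  side-component {x} {y} {X = X} e sep (_ , _ , w) = go w
    where
    go : ∀ {u v} → Star (Induced G (_∉ X)) u v → Side D x y u → Side D x y v
    go ε su                   = su
    go ((u∉ , _ , uv) ◅ w) su = go w (side-step e (u∉ ∘ sep) uv su)

  orients-one-way : ∀ ω {x y} → Orients D ω x y → ¬ Orients D ω y x
  orients-one-way ω {x} {y} o o′ with o ω (≈-refl G em ω) | o′ ω (≈-refl G em ω)
  ... | n , p | n′ , p′ = proj₂ (p n′) (subst (λ k → Side D x y (at ω k)) (+-comm n′ n) (proj₁ (p′ n)))

  orients-resp : ∀ ω ω′ {x y} → _≈_ G ω ω′ → Orients D ω x y → Orients D ω′ x y
  orients-resp ω ω′ ω≈ω′ o R R≈ω′ = o R (≈-trans G em R ω′ ω R≈ω′ (≈-sym G em ω ω′ ω≈ω′))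

  -- One vertex of the tail beyond `X` decides: its component of G - X stays on one side and
  -- contains a tail of every equivalent ray.
  orients-from : ∀ {x y X N} → x ~ᵀ y → part x ∩ part y ⊆ (_∈ X) → ∀ ω →
                 (∀ i → N ≤ i → at ω i ∉ X) → Side D y x (at ω N) → Orients D ω x y
  orients-from {x} {y} {X} {N} e sep ω out s R R≈ω with R≈ω X
  ... | m , n , same = m , λ i → near i , λ far → proj₁ (same i 0) (sep (side-∩ e far (near i)))
    where
    near : ∀ i → Side D y x (at R (m + i))
    near i = side-component (~ᵀ-sym e) (λ (p , q) → sep (q , p))
      (sc-trans G (tail-component G em ω out N (n + N) ≤-refl (m≤n+m N n)) (sc-sym G (same i N))) s

  orients-total : ∀ {x y} → x ~ᵀ y → Finite (part x ∩ part y) → ∀ ω →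
                  Orients D ω x y ⊎ Orients D ω y x
  orients-total e (X , sep) ω with ray-avoids G em ω X
  ... | N , out with side-total e (at ω N)
  ...   | inj₁ s = inj₂ (orients-from (~ᵀ-sym e) (λ (p , q) → sep (q , p)) ω out s)
  ...   | inj₂ s = inj₁ (orients-from e sep ω out s)

  -- `s` is the node just before a walk from `t′` first reaches `t`.
  first-edge : ∀ {t t′} → t′ ≢ t → ∃[ s ] s ~ᵀ t × Reach s t t′
  first-edge {t} {t′} = go (proj₂ (proj₁ isTree) t′ t)
    where
    go : ∀ {t′} → Star _~ᵀ_ t′ t → t′ ≢ t → ∃[ s ] s ~ᵀ t × Reach s t t′
    go ε t≢t = ⊥-elim (t≢t refl)
    go (_◅_ {i = t′} {j = t″} d w) t′≢t with em {P = t″ ≡ t}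
    ... | yes refl = t′ , d , ε
    ... | no t″≢t  = let (s , e , r) = go w t″≢t in
      s , e , r ◅◅ (~ᵀ-sym d , (λ (_ , q) → t′≢t q) , (λ (p , _) → t″≢t p)) ◅ ε

  -- The only edge at the leaf `t` is the deleted one, so its component of T - ts is `t` alone.
  leaf-side : ∀ {s t} → t ~ᵀ s → (∀ s′ → t ~ᵀ s′ → s′ ≡ s) → Side D t s ⊆ part t
  leaf-side e only (_ , ε , vt) = vt
  leaf-side e only (_ , (d , ¬p , _) ◅ _ , _) = ⊥-elim (¬p (refl , only _ d))

  module _ (ω : Ray G) (orientation : ∀ {x y} → x ~ᵀ y → Orients D ω x y ⊎ Orients D ω y x) where

    -- If ω lives nowhere, then following the orientation traces a ray of T.
    lives-somewhere : Rayless T → ∃ (LivesAt D ω)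
    lives-somewhere rayless = decidable-stable em λ nowhere →
      rayless (escape λ t lives → nowhere (t , lives))
      where
      escape : (∀ t → ¬ LivesAt D ω t) → Ray T
      escape nowhere = record { at = r ; injective = inj _ _ ; adjacent = r~ }
        where
        out : ∀ t → ∃[ s ] t ~ᵀ s × Orients D ω t s
        out t = decidable-stable em λ none → nowhere t λ s e →
          [ id , (λ o → ⊥-elim (none (s , ~ᵀ-sym e , o))) ]′ (orientation e)
        r : ℕ → Vᵀ
        r zero    = proj₁ (proj₁ isTree)
        r (suc n) = proj₁ (out (r n))
        r~ : ∀ n → r n ~ᵀ r (suc n)
        r~ n = proj₁ (proj₂ (out (r n)))
        r→ : ∀ n → Orients D ω (r n) (r (suc n))
        r→ n = proj₂ (proj₂ (out (r n)))
        -- The traced walk never recrosses its edge from `r n` to `r (suc n)`: going back over it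
        -- would orient it both ways, and meeting `r n` again in another way would bypass it.
        -- Injectivity follows.
        stays : ∀ n k → Reach (r (suc n)) (r n) (r (k + suc n))
        stays n zero = ε
        stays n (suc k) = stays n k ◅◅ (r~ (k + suc n) , backwards , forwards) ◅ ε
          where
          backwards : ¬ (r (k + suc n) ≡ r (suc n) × r (suc k + suc n) ≡ r n)
          backwards (p , q) = orients-one-way ω (r→ n)
            (subst₂ (Orients D ω) p q (r→ (k + suc n)))
          forwards : ¬ (r (k + suc n) ≡ r n × r (suc k + suc n) ≡ r (suc n))
          forwards (p , _) = edge-not-bypassed (~ᵀ-sym (r~ n)) (subst (Reach _ _) p (stays n k))
        distinct : ∀ {i j} → i < j → r i ≢ r j
        distinct {i} {j} i<j eq = edge-not-bypassed (~ᵀ-sym (r~ i))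
          (subst (Reach _ _) (trans (cong r (m∸n+n≡m i<j)) (sym eq)) (stays i (j ∸ suc i)))
        inj : ∀ i j → r i ≡ r j → i ≡ j
        inj i j eq with <-cmp i j
        ... | tri< i<j _ _ = ⊥-elim (distinct i<j eq)
        ... | tri≈ _ i≡j _ = i≡j
        ... | tri> _ _ j<i = ⊥-elim (distinct j<i (sym eq))

  -- If `X` covered the part, a vertex of ω beyond `X` would lie in another part, and a tail of ω
  -- would be trapped on that side of the first edge at `t`, against the orientation towards `t`.
  lives-infinite : ∀ ω {t} → LivesAt D ω t → ¬ Finite (part t)
  lives-infinite ω {t} lives (X , fin) with ray-avoids G em ω X
  ... | N , out with covers (at ω N)
  ...   | t′ , ωt′ with first-edge {t} {t′} (λ { refl → out N ≤-refl (fin ωt′) })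
  ...     | s , e , r with lives s e ω (≈-refl G em ω)
  ...       | n , tail = proj₂ (tail N)
    (side-component e (λ (_ , q) → fin q)
      (tail-component G em ω out N (n + N) ≤-refl (m≤n+m N n)) (t′ , r , ωt′))

  -- Delete the separator and the vertices of `U` in the part: the component of ω then lies inside
  -- the leaf part, where no vertex of `U` is left.
  leaf-end-no-limit : ∀ {U : Pred V ℓ} ω {s t X Y} → LivesAt D ω t →
    t ~ᵀ s → (∀ s′ → t ~ᵀ s′ → s′ ≡ s) → part t ∩ part s ⊆ (_∈ X) → part t ∩ U ⊆ (_∈ Y) → ¬ ∂Ω G U ω
  leaf-end-no-limit ω {s} {t} {X} {Y} lives ts only sep fin ω∈∂
    with ω∈∂ (X ++ Y) | lives s (~ᵀ-sym ts) ω (≈-refl G em ω)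
  ... | v , v∈C , v∈U | n , tail with v∈C ω (≈-refl G em ω)
  ...   | m , same = proj₁ (proj₂ (same n)) (∈-++⁺ʳ X (fin (v∈t , v∈U)))
    where
    v∈t : part t v
    v∈t = leaf-side ts only
      (side-component ts (∈-++⁺ˡ ∘ sep) (same n)
        (subst (λ k → Side D t s (at ω k)) (+-comm n m) (proj₁ (tail m))))

  no-limit : ∀ {U : Pred V ℓ} → RaylessWithFiniteParts D U → FiniteSeparators D → ∀ ω → ¬ ∂Ω G U ω
  no-limit (rayless , U-fin , nonleaf-fin) sep-fin ω =
    let (t , lives)     = lives-somewhere ω (λ e → orients-total e (sep-fin e) ω) rayless
        (s , ts , only) = decidable-stable em (lives-infinite ω lives ∘ nonleaf-fin t)
    in leaf-end-no-limit ω lives ts only (proj₂ (sep-fin ts)) (proj₂ (U-fin t))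

  -- Combs against rayless tree-decompositions

  module _ {U : Pred V ℓ} (K : Comb G) (K-U : AttachedTo G U K) where
    open Comb K

    some-path-avoids : ∀ X → ∃[ i ] (∀ {v} → v ∈ pathVertices G (path i) → v ∉ X)
    some-path-avoids X =
      let (N , out) = eventually-avoids G em (λ i v → v ∈ pathVertices G (path i)) disjoint X
      in N , out N ≤-refl

    spine-limit : ∂Ω G U spine
    spine-limit X with ray-avoids G em spine X
    -- Avoiding the first `N` spine vertices as well forces the path to start on the tail of the
    -- spine that avoids `X`.
    ... | N , out with some-path-avoids (X ++ map (at spine) (upTo N))
    ...   | i , avoids = tooth i , tooth∈C , K-U i
      where
      onPath : ∀ {v} → v ∈ pathVertices G (path i) → SameComponent G (_∉ X) (first i) v
      onPath = walk-component G (proj₁ (path i)) (All.tabulate λ v∈ v∈X → avoids v∈ (∈-++⁺ˡ v∈X))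
      first∈ : first i ∈ pathVertices G (path i)
      first∈ = start∈ G (proj₁ (path i))
      tooth∈C : C G X spine (tooth i)
      tooth∈C R R≈ with R≈ X | Equivalence.from (meets i first∈) refl
      ... | m , n , same | k , eq = m , λ j → sc-trans G (same j N)
            (sc-trans G (tail-component G em spine out (n + N) k (m≤n+m N n) N≤k)
              (subst (λ u → SameComponent G (_∉ X) u (tooth i)) (sym eq)
                (onPath (end∈ G (proj₁ (path i))))))
        where
        N≤k : N ≤ k
        N≤k = ≮⇒≥ λ k<N → avoids first∈
          (∈-++⁺ʳ X (subst (_∈ _) eq (∈-map⁺ (at spine) (∈-upTo⁺ k<N))))

    no-finite-cover : ∀ {X} → ¬ (U ⊆ (_∈ X))
    no-finite-cover {X} U⊆X with some-path-avoids X
    ... | i , avoids = avoids (end∈ G (proj₁ (path i))) (U⊆X (K-U i))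

  -- If the separator at xy is infinite, then x and y are leaves, so T has no other nodes.
  no-comb : ∀ {U : Pred V ℓ} → RaylessWithFiniteParts D U → (K : Comb G) → ¬ AttachedTo G U K
  no-comb {U} R@(rayless , U-fin , nonleaf-fin) K K-U with em {P = ∃₂ λ x y → x ~ᵀ y × ¬ Finite (part x ∩ part y)}
  ... | no none = no-limit R (λ e → decidable-stable em λ inf → none (_ , _ , e , inf))
                    (Comb.spine K) (spine-limit K K-U)
  ... | yes (x , y , e , inf)
    with decidable-stable em (λ nl → inf (let (X , f) = nonleaf-fin x nl in X , f ∘ proj₁))
       | decidable-stable em (λ nl → inf (let (Y , f) = nonleaf-fin y nl in Y , f ∘ proj₂))
       | U-fin x | U-fin y
  ...   | x′ , _ , onlyx | y′ , _ , onlyy | X , fx | Y , fy = no-finite-cover K K-U cover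
    where
    cover : U ⊆ (_∈ X ++ Y)
    cover {v} v∈U with side-total e v
    ... | inj₁ s = ∈-++⁺ˡ (fx (leaf-side e (λ s e′ → trans (onlyx s e′) (sym (onlyx y e))) s , v∈U))
    ... | inj₂ s = ∈-++⁺ʳ X (fy (leaf-side (~ᵀ-sym e)
                     (λ s e′ → trans (onlyy s e′) (sym (onlyy x (~ᵀ-sym e)))) s , v∈U))

  module _ (ext : ∀ {a b} → Extensionality a b) where
    open Characteristic em ext

    choose : (Vᵀ → Lift ℓ Bool) → Vᵀ
    choose h with em {P = ∃[ t ] h t ≡ lift true}
    ... | yes (t , _) = t
    ... | no _        = proj₁ (proj₁ isTree)

    choose-correct : (h : Vᵀ → Lift ℓ Bool) → (∃[ t ] h t ≡ lift true) → h (choose h) ≡ lift true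
    choose-correct h ex with em {P = ∃[ t ] h t ≡ lift true}
    ... | yes (_ , p) = p
    ... | no ¬p       = ⊥-elim (¬p ex)

    displays : ∀ {U : Pred V ℓ} → RaylessWithFiniteParts D U → FiniteSeparators D →
               Displays D (∂Ω G U)
    displays R@(rayless , _) sep-fin = record
      { finiteSeparators = sep-fin
      ; τ                = λ ω → inj₂ (node ω)
      ; τ-cong           = λ {ω} {ω′} ω≈ω′ → inj₂ (cong choose
                             (χ-cong (LivesAt D ω) (LivesAt D ω′)
                               (λ lives s e → orients-resp ω ω′ ω≈ω′ (lives s e))
                               (λ lives s e → orients-resp ω′ ω (≈-sym G em ω ω′ ω≈ω′) (lives s e))))
      ; τ-correct        = λ ω → χ⁻ (LivesAt D ω) (choose-correct (χ (LivesAt D ω))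
                             (let (t , lives) = lives-somewhere ω (λ e → orients-total e (sep-fin e) ω) rayless
                              in t , χ⁺ (LivesAt D ω) lives))
      ; τΨ               = λ (ω , ω∈∂) → ⊥-elim (no-limit R sep-fin ω ω∈∂)
      ; τΨ-restricts     = λ ω ω∈∂ → ⊥-elim (no-limit R sep-fin ω ω∈∂)
      ; τΨ-bijective     = (λ {(ω , ω∈∂)} → ⊥-elim (no-limit R sep-fin ω ω∈∂)) ,
                           (λ η → ⊥-elim (rayless η))
      ; τ-outside        = λ ω _ → node ω , refl
      }
      where
      -- Equivalent rays have equal characteristic functions and so get the same node.
      node : Ray G → Vᵀ
      node ω = choose (χ (LivesAt D ω))

-- Depth-first exploration

module Construction
  (em : ∀ {a} → ExcludedMiddle a) (ext : ∀ {a b} → Extensionality a b)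
  {G : Graph ℓ} (connected : Connected G) (U : Pred (Graph.V G) ℓ) where
  open Graph G
  open Walks
  open Characteristic em ext

  VSet : Set ℓ
  VSet = V → Lift ℓ Bool

  ⟦_⟧ : VSet → Pred V ℓ
  ⟦ D ⟧ v = D v ≡ lift true

  Meets : VSet → Set ℓ
  Meets D = ∃[ u ] ⟦ D ⟧ u × U u

  _∖_ : VSet → V → Pred V ℓ
  (D ∖ c) v = ⟦ D ⟧ v × v ≢ c

  -- As a Boolean function, a component does not depend on the vertex v that names it; hence
  -- neither does the centre picked in it.
  component : VSet → V → V → VSet
  component D c v = χ (SameComponent G (D ∖ c) v)

  PathToU : VSet → V → ℕ → Set ℓ
  PathToU D d k = ∃[ u ] U u × Σ[ p ∈ Path G d u ]
    All ⟦ D ⟧ (pathVertices G p) × length (pathVertices G p) ≡ k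

  Candidate : VSet → V → V → ℕ → Set ℓ
  Candidate D c d k = c ~ d × PathToU D d k

  Closest : VSet → V → V → Set ℓ
  Closest D c d = ∃[ k ] Candidate D c d k × (∀ d′ j → Candidate D c d′ j → k ≤ j)

  -- A region that avoids `U` has no candidates, but it still receives a centre inside it, which
  -- will represent this leftover component in the tree.
  pick : VSet → V → V
  pick D c with em {P = ∃ (Closest D c)} | em {P = ∃ ⟦ D ⟧}
  ... | yes (d , _) | _           = d
  ... | no _        | yes (d , _) = d
  ... | no _        | no _        = c

  PathToU⇒∈ : ∀ {D d k} → PathToU D d k → ⟦ D ⟧ d
  PathToU⇒∈ (_ , _ , p , all , _) = All.lookup all (start∈ G (proj₁ p))

  pick-∈ : ∀ D c {v} → ⟦ D ⟧ v → ⟦ D ⟧ (pick D c)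
  pick-∈ D c {v} v∈D with em {P = ∃ (Closest D c)} | em {P = ∃ ⟦ D ⟧}
  ... | yes (_ , _ , (_ , p) , _) | _            = PathToU⇒∈ p
  ... | no _                      | yes (_ , d∈) = d∈
  ... | no _                      | no none      = ⊥-elim (none (v , v∈D))

  pick-closest : ∀ {D c d k} → Candidate D c d k → Closest D c (pick D c)
  pick-closest {D} {c} {d} {k} cand with em {P = ∃ (Closest D c)} | em {P = ∃ ⟦ D ⟧}
  ... | yes (_ , closest) | _ = closest
  ... | no none           | _ =
    let (k′ , (d′ , cand′) , min) = least em (λ j → ∃[ d ] Candidate D c d j) k (d , cand)
    in ⊥-elim (none (d′ , k′ , cand′ , λ d″ j cand″ → min j (d″ , cand″)))

  record State : Set ℓ where
    constructor ⟨_,_⟩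
    field
      region : VSet
      centre : V
  open State

  record Good (s : State) : Set ℓ where
    field
      centre∈ : ⟦ region s ⟧ (centre s)
      connect : ∀ {v} → ⟦ region s ⟧ v → Star (Induced G ⟦ region s ⟧) v (centre s)
  open Good

  next : State → V → State
  next ⟨ D , c ⟩ v = let D′ = component D c v in ⟨ D′ , pick D′ c ⟩

  next-∋ : ∀ s {v} → ⟦ region s ⟧ v → v ≢ centre s → ⟦ region (next s v) ⟧ v
  next-∋ s v∈ v≢c = χ⁺ _ (sc-refl G (v∈ , v≢c))

  next-⊆ : ∀ s v → ⟦ region (next s v) ⟧ ⊆ (region s ∖ centre s)
  next-⊆ s v w∈ = proj₁ (proj₂ (χ⁻ (SameComponent G _ v) w∈))

  next-cong : ∀ s {v w} → ⟦ region (next s v) ⟧ w → next s w ≡ next s v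
  next-cong s {v} {w} w∈ = cong (λ D → ⟨ D , pick D (centre s) ⟩)
    (χ-cong (SameComponent G _ w) (SameComponent G _ v)
      (sc-trans G (χ⁻ (SameComponent G _ v) w∈))
      (sc-trans G (sc-sym G (χ⁻ (SameComponent G _ v) w∈))))

  next-good : ∀ s {v} → ⟦ region s ⟧ v → v ≢ centre s → Good (next s v)
  next-good s {v} v∈ v≢c = record
    { centre∈ = c′∈
    ; connect = λ w∈ → map⋆ (λ (p , q , e) → χ⁺ _ p , χ⁺ _ q , e)
        (component-walk G (χ⁻ (SameComponent G _ v) w∈)
          (proj₂ (proj₂ (sc-trans G (sc-sym G (χ⁻ (SameComponent G _ v) w∈))
                                    (χ⁻ (SameComponent G _ v) c′∈)))))
    }
    where
    c′∈ : ⟦ region (next s v) ⟧ (centre (next s v))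
    c′∈ = pick-∈ (component (region s) (centre s) v) (centre s) (next-∋ s v∈ v≢c)

  good-connected : ∀ {s} → Good s → ∀ {v w} → ⟦ region s ⟧ v → ⟦ region s ⟧ w →
                   Star (Induced G ⟦ region s ⟧) v w
  good-connected g v∈ w∈ = connect g v∈ ◅◅ reverse (step⁻ G) (connect g w∈)

  -- `d` is the vertex just before the walk first reaches `c`.
  last-exit : ∀ {D c v} → Star (Induced G ⟦ D ⟧) v c → v ≢ c →
              ∃[ d ] SameComponent G (D ∖ c) v d × c ~ d
  last-exit ε v≢c = ⊥-elim (v≢c refl)
  last-exit {c = c} (_◅_ {i = v} {j = x} (v∈ , x∈ , e) w) v≢c with em {P = x ≡ c}
  ... | yes refl = v , sc-refl G (v∈ , v≢c) , ~-sym e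
  ... | no x≢c   = let (d , x⋯d , cd) = last-exit w x≢c in
    d , sc-trans G (sc-step G (v∈ , v≢c) (x∈ , x≢c) e) x⋯d , cd

  -- Candidates exist: connectedness of the region gives the component a neighbour of the old
  -- centre, and connectedness of the component joins it to `U`.
  next-closest : ∀ s {v} → Good s → ⟦ region s ⟧ v → v ≢ centre s → Meets (region (next s v)) →
                 Closest (region (next s v)) (centre s) (centre (next s v))
  next-closest s {v} g v∈ v≢c (u , u∈ , Uu) =
    let (d , v⋯d , cd) = last-exit (connect g v∈) v≢c
        (w , uq)       = walk⇒path G em (proj₂ ∘ proj₂)
                           (good-connected (next-good s v∈ v≢c) (χ⁺ _ v⋯d) u∈)
    in pick-closest (cd , u , Uu , (map⋆ (proj₂ ∘ proj₂) w , uq) ,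
                     induced-vertices G (χ⁺ _ v⋯d) w , refl)

  -- The comb along an infinite branch

  module DescendingSequence
    (s : ℕ → State) (v : ℕ → V) (good₀ : Good (s 0))
    (v∈ : ∀ i → ⟦ region (s i) ⟧ (v i)) (v≢ : ∀ i → v i ≢ centre (s i))
    (s-next : ∀ i → s (suc i) ≡ next (s i) (v i)) (meets : ∀ i → Meets (region (s (suc i)))) where

    good : ∀ i → Good (s i)
    good zero    = good₀
    good (suc i) = subst Good (sym (s-next i)) (next-good (s i) (v∈ i) (v≢ i))

    shrink : ∀ i → ⟦ region (s (suc i)) ⟧ ⊆ (region (s i) ∖ centre (s i))
    shrink i w∈ = next-⊆ (s i) (v i) (subst (λ t → ⟦ region t ⟧ _) (s-next i) w∈)

    shrink* : ∀ {i j} → i ≤ j → ⟦ region (s j) ⟧ ⊆ ⟦ region (s i) ⟧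
    shrink* {i} {zero}  z≤n w∈ = w∈
    shrink* {i} {suc j} i≤ w∈ with m≤n⇒m<n∨m≡n i≤
    ... | inj₁ (s≤s i≤j) = shrink* i≤j (proj₁ (shrink j w∈))
    ... | inj₂ refl      = w∈

    -- The shift by one is due to `s 0`, whose region is not assumed to meet `U` and whose centre is
    -- not assumed to be picked closest to `U`.
    c : ℕ → V
    c i = centre (s (suc i))

    R : ℕ → VSet
    R i = region (s (suc i))

    R-mono : ∀ {i j} → i ≤ j → ⟦ R j ⟧ ⊆ ⟦ R i ⟧
    R-mono i≤j = shrink* (s≤s i≤j)

    c∈R : ∀ {i j} → i ≤ j → ⟦ R i ⟧ (c j)
    c∈R i≤j = R-mono i≤j (centre∈ (good _))

    c∉R : ∀ {i j} → i < j → ¬ ⟦ R j ⟧ (c i)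
    c∉R i<j c∈ = proj₂ (shrink _ (R-mono i<j c∈)) refl

    c-injective : ∀ i j → c i ≡ c j → i ≡ j
    c-injective i j eq with <-cmp i j
    ... | tri< i<j _ _ = ⊥-elim (c∉R i<j (subst ⟦ R j ⟧ (sym eq) (c∈R ≤-refl)))
    ... | tri≈ _ i≡j _ = i≡j
    ... | tri> _ _ j<i = ⊥-elim (c∉R j<i (subst ⟦ R i ⟧ eq (c∈R ≤-refl)))

    abstract
      closest : ∀ i → Closest (R i) (centre (s i)) (c i)
      closest i = subst (λ t → Closest (region t) (centre (s i)) (centre t)) (sym (s-next i))
        (next-closest (s i) (good i) (v∈ i) (v≢ i) (subst (Meets ∘ region) (s-next i) (meets i)))

    -- The number of vertices on a shortest path from `c i` to `U` inside `R i`.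
    order : ℕ → ℕ
    order i = proj₁ (closest i)

    c~ : ∀ i → c i ~ c (suc i)
    c~ i = proj₁ (proj₁ (proj₂ (closest (suc i))))

    ray : Ray G
    ray = record { at = c ; injective = c-injective _ _ ; adjacent = c~ }

    -- Confinement to `R i` minus `R (suc i)` makes these paths disjoint for different `i` and lets
    -- them meet the ray in `c i` only.
    Tooth : ℕ → Set ℓ
    Tooth i = ∃[ u ] U u × Σ[ p ∈ Path G (c i) u ]
      All (λ w → ⟦ R i ⟧ w × ¬ ⟦ R (suc i) ⟧ w) (pathVertices G p)

    -- `R (suc i)` is a component of `R i` minus `c i`, so it contains all or nothing of a walk
    -- there.
    stays-inside : ∀ i {x u} (w : Star _~_ x u) → All (R i ∖ c i) (vertices G w) →
                   ∀ {y z} → y ∈ vertices G w → z ∈ vertices G w → ⟦ R (suc i) ⟧ y → ⟦ R (suc i) ⟧ z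
    stays-inside i w all y∈ z∈ y∈R = subst (λ t → ⟦ region t ⟧ _) (sym (s-next (suc i)))
      (χ⁺ (SameComponent G _ _)
        (sc-trans G (χ⁻ (SameComponent G _ _) (subst (λ t → ⟦ region t ⟧ _) (s-next (suc i)) y∈R))
          (sc-trans G (sc-sym G (walk-component G w all y∈)) (walk-component G w all z∈))))

    -- After `c i` the path runs either wholly outside `R (suc i)`, giving a tooth, or wholly
    -- inside, giving a candidate with one vertex fewer.
    split : ∀ i {u} → U u → (p : Path G (c i) u) → All ⟦ R i ⟧ (pathVertices G p) →
            Tooth i ⊎ (∃₂ λ d k → Candidate (R (suc i)) (c i) d k × k < length (pathVertices G p))
    split i Uu (ε , uq) (r ∷ []) = inj₁ (_ , Uu , (ε , uq) , (r , c∉R ≤-refl) ∷ [])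
    split i Uu (_◅_ {j = x} e w , c≢ ∷ uq) (r ∷ rs) = decide em
      where
      inside : All (R i ∖ c i) (vertices G w)
      inside = All.tabulate λ z∈ → All.lookup rs z∈ , λ eq → All.lookup c≢ z∈ (sym eq)
      decide : Dec (⟦ R (suc i) ⟧ x) → Tooth i ⊎ (∃₂ λ d k → Candidate (R (suc i)) (c i) d k × k < _)
      decide (yes x∈) = inj₂ (x , _ , (e , _ , Uu , (w , uq) ,
        All.tabulate (λ z∈ → stays-inside i w inside (start∈ G w) z∈ x∈) , refl) , ≤-refl)
      decide (no x∉) = inj₁ (_ , Uu , (e ◅ w , c≢ ∷ uq) , (r , c∉R ≤-refl) ∷
        All.tabulate (λ z∈ → All.lookup rs z∈ , λ z∈R → x∉ (stays-inside i w inside z∈ (start∈ G w) z∈R)))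

    abstract
      tooth-or-closer : ∀ i → Tooth i ⊎ order (suc i) < order i
      tooth-or-closer i =
        let (k , (_ , u , Uu , p , all , len) , _) = closest i
        in [ inj₁
           , (λ (d , k′ , cand , k′<) →
               inj₂ (≤-<-trans (proj₂ (proj₂ (closest (suc i))) d k′ cand) (<-≤-trans k′< (≤-reflexive len))))
           ]′ (split i Uu p all)

      -- Without a tooth from `N` on, `order` would decrease forever.
      tooth-beyond : ∀ N → ∃[ i ] N ≤ i × Tooth i
      tooth-beyond N = decidable-stable em λ none → no-descent (λ j → order (j + N)) λ j →
        [ (λ t → ⊥-elim (none (j + N , m≤n+m N j , t))) , id ]′ (tooth-or-closer (j + N))

    index : ℕ → ℕ
    index zero    = proj₁ (tooth-beyond 0)
    index (suc j) = proj₁ (tooth-beyond (suc (index j)))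

    index-step : ∀ j → index j < index (suc j)
    index-step j = proj₁ (proj₂ (tooth-beyond (suc (index j))))

    index-mono : ∀ {i j} → i < j → index i < index j
    index-mono {i} {suc j} (s≤s i≤j) with m≤n⇒m<n∨m≡n i≤j
    ... | inj₁ i<j  = <-trans (index-mono i<j) (index-step j)
    ... | inj₂ refl = index-step j

    tooth-at : ∀ j → Tooth (index j)
    tooth-at zero    = proj₂ (proj₂ (tooth-beyond 0))
    tooth-at (suc j) = proj₂ (proj₂ (tooth-beyond (suc (index j))))

    tooth-path : ∀ j → Path G (c (index j)) (proj₁ (tooth-at j))
    tooth-path j = proj₁ (proj₂ (proj₂ (tooth-at j)))

    tooth-path-region : ∀ j {w} → w ∈ pathVertices G (tooth-path j) →
                        ⟦ R (index j) ⟧ w × ¬ ⟦ R (suc (index j)) ⟧ w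
    tooth-path-region j = All.lookup (proj₂ (proj₂ (proj₂ (tooth-at j))))

    tooth-paths-disjoint : ∀ i j {w} → w ∈ pathVertices G (tooth-path i) →
                           w ∈ pathVertices G (tooth-path j) → i ≡ j
    tooth-paths-disjoint i j w∈i w∈j with <-cmp i j
    ... | tri< i<j _ _ = ⊥-elim (proj₂ (tooth-path-region i w∈i)
                           (R-mono (index-mono i<j) (proj₁ (tooth-path-region j w∈j))))
    ... | tri≈ _ i≡j _ = i≡j
    ... | tri> _ _ j<i = ⊥-elim (proj₂ (tooth-path-region j w∈j)
                           (R-mono (index-mono j<i) (proj₁ (tooth-path-region i w∈i))))

    on-spine : ∀ j n → c n ∈ pathVertices G (tooth-path j) → c n ≡ c (index j)
    on-spine j n c∈ with <-cmp n (index j)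
    ... | tri< n<i _ _ = ⊥-elim (c∉R n<i (proj₁ (tooth-path-region j c∈)))
    ... | tri≈ _ n≡i _ = cong c n≡i
    ... | tri> _ _ i<n = ⊥-elim (proj₂ (tooth-path-region j c∈) (c∈R i<n))

    comb : ∃ λ (K : Comb G) → AttachedTo G U K
    comb = record
      { spine    = ray
      ; first    = λ j → c (index j)
      ; tooth    = λ j → proj₁ (tooth-at j)
      ; path     = tooth-path
      ; disjoint = λ {i} {j} → tooth-paths-disjoint i j
      ; meets    = λ j w∈ → mk⇔ (λ { (n , refl) → on-spine j n w∈ }) (λ eq → index j , sym eq)
      } , λ j → proj₁ (proj₂ (tooth-at j))

  -- The exploration in the absence of a comb

  module WithoutComb (no-comb : ¬ ∃ λ (K : Comb G) → AttachedTo G U K) where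

    root : V
    root = proj₁ connected

    run : V → ℕ → State
    run v zero    = ⟨ (λ _ → lift true) , root ⟩
    run v (suc n) = next (run v n) v

    region-at : V → ℕ → VSet
    region-at v n = region (run v n)

    centre-at : V → ℕ → V
    centre-at v n = centre (run v n)

    -- The exploration never stops at stage 0 for want of vertices in U, so that the part at the
    -- root is finite even if U is empty.
    Stopped : V → ℕ → Set ℓ
    Stopped v n = v ≡ centre-at v n ⊎ (n ≢ 0 × ¬ Meets (region-at v n))

    initial-good : ∀ v → Good (run v 0)
    initial-good v = record
      { centre∈ = refl
      ; connect = λ {w} _ → map⋆ (λ e → refl , refl , e) (proj₂ connected w root)
      }

    alive : ∀ v n → (∀ m → m < n → ¬ Stopped v m) → Good (run v n) × ⟦ region-at v n ⟧ v
    alive v zero    _   = initial-good v , refl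
    alive v (suc n) run↓ =
      let (_ , v∈) = alive v n (λ m m<n → run↓ m (m<n⇒m<1+n m<n))
          v≢c      = run↓ n ≤-refl ∘ inj₁
      in next-good (run v n) v∈ v≢c , next-∋ (run v n) v∈ v≢c

    -- An endless run is a descending sequence of regions meeting `U` and would produce a comb.
    stops : ∀ v → ∃ (Stopped v)
    stops v = decidable-stable em λ never →
      let running n = λ p → never (n , p) in
      no-comb (DescendingSequence.comb (run v) (λ _ → v) (initial-good v)
        (λ i → proj₂ (alive v i (λ m _ → running m)))
        (λ i → running i ∘ inj₁)
        (λ _ → refl)
        (λ i → decidable-stable em λ misses → running (suc i) (inj₂ ((λ ()) , misses))))

    abstract
      first-stop : ∀ v → ∃[ k ] Stopped v k × (∀ j → Stopped v j → k ≤ j)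
      first-stop v = least em (Stopped v) (proj₁ (stops v)) (proj₂ (stops v))

    depth : V → ℕ
    depth v = proj₁ (first-stop v)

    stopped : ∀ v → Stopped v (depth v)
    stopped v = proj₁ (proj₂ (first-stop v))

    running : ∀ {v n} → n < depth v → ¬ Stopped v n
    running {v} n<d st = <⇒≱ n<d (proj₂ (proj₂ (first-stop v)) _ st)

    home : V → VSet
    home v = region-at v (depth v)

    top : V → V
    top v = centre-at v (depth v)

    -- The nodes below which the exploration continues. Either alternative excludes stopping for
    -- want of `U`, so `v` is the centre of its home.
    Internal : Pred V ℓ
    Internal v = depth v ≡ 0 ⊎ Meets (home v)

    running-good : ∀ {v n} → n ≤ depth v → Good (run v n)
    running-good {v} {n} n≤d = proj₁ (alive v n λ m m<n → running (<-≤-trans m<n n≤d))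

    running-∋ : ∀ {v n} → n ≤ depth v → ⟦ region-at v n ⟧ v
    running-∋ {v} {n} n≤d = proj₂ (alive v n λ m m<n → running (<-≤-trans m<n n≤d))

    running-meets : ∀ {v n} → suc n < depth v → Meets (region-at v (suc n))
    running-meets n<d = decidable-stable em λ misses → running n<d (inj₂ ((λ ()) , misses))

    region-mono : ∀ v {m n} → m ≤ n → ⟦ region-at v n ⟧ ⊆ ⟦ region-at v m ⟧
    region-mono v {m} {zero}  z≤n w∈ = w∈
    region-mono v {m} {suc n} m≤ w∈ with m≤n⇒m<n∨m≡n m≤
    ... | inj₁ (s≤s m≤n) = region-mono v m≤n (proj₁ (next-⊆ (run v n) v w∈))
    ... | inj₂ refl      = w∈

    -- A state depends only on the components entered so far. Nor does `w` stop earlier: a region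
    -- excludes all previous centres, and every region beyond the first through which `v` has passed
    -- meets `U`.
    agree : ∀ {v w} n → n ≤ depth v → ⟦ region-at v n ⟧ w → run w n ≡ run v n × n ≤ depth w
    agree zero n≤d w∈ = refl , z≤n
    agree {v} {w} (suc n) n<d w∈ with agree n (<⇒≤ n<d) (region-mono v (n≤1+n n) w∈)
    ... | eq , n≤d = trans (cong (λ s → next s w) eq) (next-cong (run v n) w∈) ,
                     ≤∧≢⇒< n≤d λ { refl → clash (stopped w) }
      where
      clash : ¬ Stopped w n
      clash (inj₁ w≡c) = proj₂ (next-⊆ (run v n) v w∈) (trans w≡c (cong centre eq))
      clash (inj₂ (n≢0 , misses)) = running n<d (inj₂ (n≢0 , subst (¬_ ∘ Meets ∘ region) eq misses))

    -- As long as neither end is a centre, the edge survives and keeps both ends in one component.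
    edge-∋ : ∀ {u v} n → u ~ v → n ≤ depth u → n ≤ depth v → ⟦ region-at v n ⟧ u
    edge-∋ zero _ _ _ = refl
    edge-∋ {u} {v} (suc n) uv n<u n<v =
      let u∈       = edge-∋ n uv (<⇒≤ n<u) (<⇒≤ n<v)
          (eq , _) = agree n (<⇒≤ n<v) u∈
      in χ⁺ _ (sc-step G (running-∋ (<⇒≤ n<v) , running n<v ∘ inj₁)
                         (u∈ , λ u≡c → running n<u (inj₁ (trans u≡c (sym (cong centre eq)))))
                         (~-sym uv))

    depth-least : ∀ {v n} → Stopped v n → depth v ≤ n
    depth-least st = ≮⇒≥ λ n<d → running n<d st

    internal-top : ∀ {v} → Internal v → v ≡ top v
    internal-top {v} int with stopped v | int
    ... | inj₁ v≡c           | _          = v≡c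
    ... | inj₂ (d≢0 , _)     | inj₁ d≡0   = ⊥-elim (d≢0 d≡0)
    ... | inj₂ (_ , misses)  | inj₂ meets = ⊥-elim (misses meets)

    -- A centre lies in its own region, so it shares the run up to that stage and stops there.
    centre-run : ∀ {v n} → n ≤ depth v →
                 depth (centre-at v n) ≡ n × run (centre-at v n) n ≡ run v n
    centre-run {v} {n} n≤d =
      let (eq , n≤) = agree n n≤d (centre∈ (running-good n≤d))
      in ≤-antisym (depth-least (inj₁ (sym (cong centre eq)))) n≤ , eq

    centre-home : ∀ {v n} → n ≤ depth v → home (centre-at v n) ≡ region-at v n
    centre-home {v} {n} n≤d = let (d≡n , eq) = centre-run {v} n≤d in
      trans (cong (region-at (centre-at v n)) d≡n) (cong region eq)

    centre-internal : ∀ {v n} → n < depth v → Internal (centre-at v n)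
    centre-internal {v} {zero}  n<d = inj₁ (proj₁ (centre-run {v} (<⇒≤ n<d)))
    centre-internal {v} {suc n} n<d =
      inj₂ (subst Meets (sym (centre-home {v} (<⇒≤ n<d))) (running-meets n<d))

    top-internal : ∀ {v} → Internal (top v) → Internal v
    top-internal {v} (inj₁ d≡0)   = inj₁ (trans (sym (proj₁ (centre-run {v} ≤-refl))) d≡0)
    top-internal {v} (inj₂ meets) = inj₂ (subst Meets (centre-home {v} ≤-refl) meets)

    -- The nodes of the tree are all vertices of G.  A component left over is represented by its
    -- centre; its other vertices become leaves whose parts just repeat the chain of their parent.
    Child : V → V → Set ℓ
    Child u v = depth v ≡ suc (depth u) × run v (depth u) ≡ run u (depth u) × Internal u

    parent : ∀ {v n} → depth v ≡ suc n → Child (centre-at v n) v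
    parent {v} {n} eq =
      let n<d        = ≤-reflexive (sym eq)
          (d≡n , r≡) = centre-run {v} (<⇒≤ n<d)
      in trans eq (cong suc (sym d≡n)) ,
         subst (λ k → run v k ≡ run (centre-at v n) k) (sym d≡n) (sym r≡) ,
         centre-internal n<d

    child-depth : ∀ {u v} → Child u v → depth u < depth v
    child-depth (eq , _) = ≤-reflexive (sym eq)

    child-centre : ∀ {u v} → Child u v → u ≡ centre-at v (depth u)
    child-centre (_ , r≡ , int) = trans (internal-top int) (sym (cong centre r≡))

    child-∋ : ∀ {u v} → Child u v → ⟦ home u ⟧ v
    child-∋ {u} {v} ch@(_ , r≡ , _) =
      subst (λ s → ⟦ region s ⟧ v) r≡ (running-∋ (<⇒≤ (child-depth ch)))

    child-∈ : ∀ {u v k} → Child u v → k ≤ depth u → ⟦ region-at v k ⟧ u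
    child-∈ {u} {v} (_ , r≡ , _) k≤d =
      region-mono v k≤d (subst (λ s → ⟦ region s ⟧ u) (sym r≡) (running-∋ ≤-refl))

    parent-unique : ∀ {u u′ v} → Child u v → Child u′ v → u ≡ u′
    parent-unique {v = v} ch ch′ = trans (child-centre ch) (trans
      (cong (centre-at v) (suc-injective (trans (sym (proj₁ ch)) (proj₁ ch′))))
      (sym (child-centre ch′)))

    -- The decomposition tree

    _~ᵀ_ : Rel V ℓ
    u ~ᵀ v = Child u v ⊎ Child v u

    decompositionTree : Graph ℓ
    decompositionTree = record
      { V      = V
      ; _~_    = _~ᵀ_
      ; ~-sym  = swap
      ; irrefl = λ { (inj₁ ch) → <-irrefl refl (child-depth ch)
                   ; (inj₂ ch) → <-irrefl refl (child-depth ch) }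
      }

    -- `home v` is closed under passing to children and contains the parent of each of its nodes
    -- deeper than `v`. Its only node at the depth of `v` is `v` itself.
    enter-home : ∀ {v x y} → Internal v → x ~ᵀ y → ¬ ⟦ home v ⟧ x → ⟦ home v ⟧ y → y ≡ v
    enter-home {v} {x} {y} int (inj₁ ch) x∉ y∈ with agree (depth v) ≤-refl y∈
    ... | r≡ , dv≤dy with m≤n⇒m<n∨m≡n (≤-trans dv≤dy (≤-reflexive (proj₁ ch)))
    ...   | inj₁ (s≤s dv≤dx) = ⊥-elim (x∉ (subst (λ s → ⟦ region s ⟧ x) r≡ (child-∈ ch dv≤dx)))
    ...   | inj₂ dv≡ = trans (internal-top (y-internal int))
                         (trans (cong centre (trans (cong (run y) (sym dv≡dy)) r≡)) (sym (internal-top int)))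
      where
      dv≡dy : depth v ≡ depth y
      dv≡dy = trans dv≡ (sym (proj₁ ch))
      y-internal : Internal v → Internal y
      y-internal (inj₁ d≡0)   = inj₁ (trans (sym dv≡dy) d≡0)
      y-internal (inj₂ meets) = inj₂ (subst Meets
        (cong region (trans (sym r≡) (cong (run y) dv≡dy))) meets)
    enter-home {v} {x} {y} int (inj₂ ch) x∉ y∈ with agree (depth v) ≤-refl y∈
    ... | r≡ , dv≤dy = ⊥-elim (x∉ (subst (λ s → ⟦ region s ⟧ x) r≡
          (region-mono y dv≤dy (child-∋ ch))))

    -- The nodes at or below `v`. Nothing is below a node that is not internal, even if its home has
    -- other vertices.
    Subtree : V → Pred V ℓ
    Subtree v t = t ≡ v ⊎ (Internal v × ⟦ home v ⟧ t)

    edge-to-subtree-root : ∀ {v x} → x ~ᵀ v → ¬ Subtree v x → Child x v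
    edge-to-subtree-root (inj₁ ch)                 _  = ch
    edge-to-subtree-root (inj₂ ch@(_ , _ , int)) x∉ = ⊥-elim (x∉ (inj₂ (int , child-∋ ch)))

    enter-subtree : ∀ {v x y} → x ~ᵀ y → ¬ Subtree v x → Subtree v y → Child x v × y ≡ v
    enter-subtree e x∉ (inj₁ refl) = edge-to-subtree-root e x∉ , refl
    enter-subtree e x∉ (inj₂ (int , y∈))
      with enter-home int e (λ x∈ → x∉ (inj₂ (int , x∈))) y∈
    ... | refl = edge-to-subtree-root e x∉ , refl

    parent∉subtree : ∀ {u v} → Child u v → ¬ Subtree v u
    parent∉subtree ch (inj₁ refl)     = <-irrefl refl (child-depth ch)
    parent∉subtree {v = v} ch (inj₂ (_ , u∈)) =
      <⇒≱ (child-depth ch) (proj₂ (agree (depth v) ≤-refl u∈))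

    to-root : ∀ n {v} → depth v ≡ n → Star _~ᵀ_ v root
    to-root zero {v} eq =
      subst (Star _~ᵀ_ v) (trans (internal-top (inj₁ eq)) (cong (centre-at v) eq)) ε
    to-root (suc n) {v} eq = inj₂ (parent eq) ◅ to-root n (proj₁ (centre-run {v} n≤d))
      where
      n≤d : n ≤ depth v
      n≤d = <⇒≤ (≤-reflexive (sym eq))

    -- The closing edge joins a parent to a child and is the only edge leaving the subtree of the
    -- child. The path must use it too: either at once, and then it has just two vertices, or later,
    -- and then it revisits `u`.
    acyclic : Acyclic decompositionTree
    acyclic (u , v , (ε , _) , s≤s () , _)
    acyclic (u , v , (_◅_ {j = x} e w , u∉ ∷ uq) , long , inj₁ ch) with em {P = Subtree u x}
    ... | no x∉ with enter-subtree (swap e) x∉ (inj₁ refl)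
    ...   | ch′ , _ with parent-unique ch ch′
    ...     | refl rewrite closed-path decompositionTree w uq with long
    ...       | s≤s (s≤s ())
    acyclic (u , v , (_◅_ {j = x} e w , u∉ ∷ uq) , long , inj₁ ch)
      | yes x∈ with crossing decompositionTree em (Subtree u) w x∈ (parent∉subtree ch)
    ... | a , b , a∈ , b∈ , ab , a-in , b-out =
      All.lookup u∉ a∈ (sym (proj₂ (enter-subtree (swap ab) b-out a-in)))
    acyclic (u , v , (_◅_ {j = x} e w , u∉ ∷ uq) , long , inj₂ ch) with em {P = Subtree v x}
    ... | yes x∈ with enter-subtree e (parent∉subtree ch) x∈
    ...   | _ , refl rewrite closed-path decompositionTree w uq with long
    ...     | s≤s (s≤s ())
    acyclic (u , v , (_◅_ {j = x} e w , u∉ ∷ uq) , long , inj₂ ch)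
      | no x∉ with crossing decompositionTree em (¬_ ∘ Subtree v) w x∉ (λ v∉ → v∉ (inj₁ refl))
    ... | a , b , a∈ , b∈ , ab , a-out , b-in =
      All.lookup u∉ a∈ (parent-unique ch (proj₁ (enter-subtree ab a-out (decidable-stable em b-in))))

    -- Specified by the nodes whose parts contain `v`: the whole subtree of an internal `v`, and
    -- otherwise only the centre of the leftover component containing `v`.
    part : V → Pred V ℓ
    part t v = (Internal v × ⟦ home v ⟧ t) ⊎ (¬ Internal v × t ≡ top v)

    top-part : ∀ v → part (top v) v
    top-part v with em {P = Internal v}
    ... | yes int = inj₁ (int , centre∈ (running-good {v} ≤-refl))
    ... | no ¬int = inj₂ (¬int , refl)

    -- The deeper end `v` lies in `home u`, and so does `top v`. If `u` is not internal, this home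
    -- avoids `U`, so `v` stops there as well and has the same top.
    deeper-part : ∀ {u v} → u ~ v → depth u ≤ depth v → part (top v) u
    deeper-part {u} {v} uv du≤dv
      with agree (depth u) ≤-refl (edge-∋ (depth u) (~-sym uv) du≤dv ≤-refl) | em {P = Internal u}
    ... | r≡ , _ | yes int = inj₁ (int , subst (λ s → ⟦ region s ⟧ (top v)) r≡
            (region-mono v du≤dv (centre∈ (running-good {v} ≤-refl))))
    ... | r≡ , _ | no ¬int = inj₂ (¬int , trans (cong (centre-at v) (≤-antisym dv≤du du≤dv)) (cong centre r≡))
      where
      dv≤du : depth v ≤ depth u
      dv≤du = depth-least (inj₂ ((¬int ∘ inj₁) , λ meets → ¬int (inj₂ (subst (Meets ∘ region) r≡ meets))))

    decomposition : TreeDecomposition G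
    decomposition = record
      { T         = decompositionTree
      ; isTree    = (root , λ u v → to-root _ refl ◅◅ reverse swap (to-root _ refl)) , acyclic
      ; part      = part
      ; covers    = λ v → top v , top-part v
      ; edges     = λ {u} {v} uv → common uv (≤-total (depth u) (depth v))
      ; coherence = coherent
      }
      where
      common : ∀ {u v} → u ~ v → depth u ≤ depth v ⊎ depth v ≤ depth u → ∃[ t ] part t u × part t v
      common {u} {v} uv (inj₁ du≤dv) = top v , deeper-part uv du≤dv , top-part v
      common {u} {v} uv (inj₂ dv≤du) = top u , top-part u , deeper-part (~-sym uv) dv≤du
      coherent : ∀ {t₁ t₂ t₃} (p : Path decompositionTree t₁ t₃) →
                 t₂ ∈ pathVertices decompositionTree p → part t₁ ∩ part t₃ ⊆ part t₂
      coherent (w , uq) t₂∈ {v} (inj₁ (int , t₁∈) , inj₁ (_ , t₃∈)) =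
        -- The gate is `v`, the only node at which its subtree can be entered.
        inj₁ (int , path-stays decompositionTree em ⟦ home v ⟧ v (enter-home int) w uq t₁∈ t₃∈ t₂∈)
      coherent (w , uq) t₂∈ (inj₂ (¬int , refl) , inj₂ (_ , refl))
        with subst (_ ∈_) (closed-path decompositionTree w uq) t₂∈
      ... | here eq = inj₂ (¬int , eq)
      coherent _ _ (inj₁ (int , _)  , inj₂ (¬int , _)) = ⊥-elim (¬int int)
      coherent _ _ (inj₂ (¬int , _) , inj₁ (int , _))  = ⊥-elim (¬int int)

    -- The internal vertices of a part are centres on the branch to its node; this bounds the parts
    -- at internal nodes and the internal vertices in every part.
    part⇒centre : ∀ {t v} → part t v → Internal t ⊎ Internal v →
                  ∃[ k ] k ≤ depth t × v ≡ centre-at t k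
    part⇒centre {t} {v} (inj₁ (int , t∈)) _ with agree (depth v) ≤-refl t∈
    ... | r≡ , dv≤dt = depth v , dv≤dt , trans (internal-top int) (sym (cong centre r≡))
    part⇒centre (inj₂ (¬int , refl)) (inj₁ int) = ⊥-elim (¬int (top-internal int))
    part⇒centre (inj₂ (¬int , refl)) (inj₂ int) = ⊥-elim (¬int int)

    centres : V → List V
    centres t = map (centre-at t) (upTo (suc (depth t)))

    part⊆centres : ∀ {t v} → part t v → Internal t ⊎ Internal v → v ∈ centres t
    part⊆centres {t} p int = let (k , k≤d , eq) = part⇒centre p int in
      subst (_∈ centres t) (sym eq) (∈-map⁺ (centre-at t) (∈-upTo⁺ (s≤s k≤d)))

    -- Leaves and rays of the tree

    nonleaf-internal : ∀ t → ¬ Leaf decompositionTree t → Internal t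
    nonleaf-internal t nonleaf = decidable-stable em λ ¬int → nonleaf (leaf ¬int (depth t) refl)
      where
      leaf : ¬ Internal t → ∀ n → depth t ≡ n → Leaf decompositionTree t
      leaf ¬int zero    eq = ⊥-elim (¬int (inj₁ eq))
      leaf ¬int (suc n) eq = centre-at t n , inj₂ (parent eq) , λ where
        s (inj₁ (_ , _ , int)) → ⊥-elim (¬int int)
        s (inj₂ ch)            → parent-unique ch (parent eq)

    -- By uniqueness of parents a ray that has once descended descends forever, which would yield a
    -- comb. Hence it always ascends, and depth decreases forever.
    rayless : Rayless decompositionTree
    rayless R = no-descent (λ i → depth (at i)) λ i → child-depth (ascending i)
      where
      open Ray R
      descends : ∀ {n} → Child (at n) (at (suc n)) → ∀ i → Child (at (i + n)) (at (suc i + n))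
      descends ch zero = ch
      descends {n} ch (suc i) with adjacent (suc i + n)
      ... | inj₁ ch′ = ch′
      ... | inj₂ ch′ = ⊥-elim (<-irrefl
              (injective (parent-unique (descends ch i) ch′)) (m<n⇒m<1+n ≤-refl))
      no-descending-tail : ∀ n → ¬ (∀ i → Child (at (i + n)) (at (suc i + n)))
      no-descending-tail n down = no-comb (DescendingSequence.comb
        (λ i → run (at (i + n)) (depth (at (i + n))))
        (λ i → at (suc i + n))
        (running-good ≤-refl)
        (λ i → child-∋ (down i))
        (λ i eq → running (child-depth (down i))
          (inj₁ (trans eq (sym (cong centre (proj₁ (proj₂ (down i))))))))
        (λ i → trans (cong (run (at (suc i + n))) (proj₁ (down i)))
          (cong (λ s → next s (at (suc i + n))) (proj₁ (proj₂ (down i)))))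
        (λ i → meets i (proj₂ (proj₂ (down (suc i))))))
        where
        meets : ∀ i → Internal (at (suc i + n)) → Meets (home (at (suc i + n)))
        meets i (inj₁ d≡0) with trans (sym d≡0) (proj₁ (down i))
        ... | ()
        meets i (inj₂ m) = m
      ascending : ∀ i → Child (at (suc i)) (at i)
      ascending i with adjacent i
      ... | inj₁ ch = ⊥-elim (no-descending-tail i (descends ch))
      ... | inj₂ ch = ch

    rayless-with-finite-parts : RaylessWithFiniteParts decomposition U
    rayless-with-finite-parts =
      rayless ,
      -- A vertex of `U` lies in its own home, which thus meets `U`; so it is internal.
      (λ t → centres t , λ {v} (p , Uv) → part⊆centres p (inj₂ (inj₂ (v , running-∋ ≤-refl , Uv)))) ,
      (λ t nonleaf → centres t , λ p → part⊆centres p (inj₁ (nonleaf-internal t nonleaf)))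

    -- Finite and connected separators

    finite-separators : FiniteSeparators decomposition
    finite-separators {x} {y} (inj₁ (_ , _ , int)) = centres x , λ (p , _) → part⊆centres p (inj₁ int)
    finite-separators {x} {y} (inj₂ (_ , _ , int)) = centres y , λ (_ , p) → part⊆centres p (inj₁ int)

    -- The strict bound ensures that the region at stage `suc k` meets `U`, so that its centre is
    -- picked among the neighbours of the previous one.
    centre-adjacent : ∀ {v k} → suc k < depth v → centre-at v k ~ centre-at v (suc k)
    centre-adjacent {v} {k} k<d = proj₁ (proj₁ (proj₂ (next-closest (run v k)
      (running-good (<⇒≤ k<)) (running-∋ (<⇒≤ k<)) (running k< ∘ inj₁) (running-meets k<d))))
      where
      k< : k < depth v
      k< = <-trans ≤-refl k<d

    module _ {x y} (ch : Child x y) where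

      centre-in-separator : ∀ {k} → k ≤ depth x → (part x ∩ part y) (centre-at y k)
      centre-in-separator {k} k≤d = inj₁ (int , in-home (child-∈ ch k≤d)) ,
                                    inj₁ (int , in-home (running-∋ (<⇒≤ k<)))
        where
        k< : k < depth y
        k< = ≤-<-trans k≤d (child-depth ch)
        int : Internal (centre-at y k)
        int = centre-internal k<
        in-home : ∀ {w} → ⟦ region-at y k ⟧ w → ⟦ home (centre-at y k) ⟧ w
        in-home {w} = subst (λ D → ⟦ D ⟧ w) (sym (centre-home {y} (<⇒≤ k<)))

      separator-centre : ∀ {v} → part x v → ∃[ k ] k ≤ depth x × v ≡ centre-at y k
      separator-centre p with part⇒centre p (inj₁ (proj₂ (proj₂ ch)))
      ... | k , k≤d , eq = k , k≤d , trans eq (cong centre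
        (proj₁ (agree k (≤-trans k≤d (<⇒≤ (child-depth ch))) (child-∈ ch k≤d))))

      -- The separator is the chain of centres from the root down to `x`, each adjacent to the next.
      -- The set `A` stands for the intersection in either order.
      chain-connected : {A : Pred V ℓ} → part x ∩ part y ⊆ A → A ⊆ part x → ConnectedSet G A
      chain-connected {A} ⊇ ⊆x = (_ , ⊇ (centre-in-separator z≤n)) , λ u∈ v∈ →
        sc-trans G (to-start u∈) (sc-sym G (to-start v∈))
        where
        back : ∀ k → k ≤ depth x → SameComponent G A (centre-at y k) (centre-at y 0)
        back zero    _   = sc-refl G (⊇ (centre-in-separator z≤n))
        back (suc k) k<d = sc-trans G
          (sc-step G (⊇ (centre-in-separator k<d)) (⊇ (centre-in-separator (<⇒≤ k<d)))
            (~-sym (centre-adjacent (≤-<-trans k<d (child-depth ch)))))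
          (back k (<⇒≤ k<d))
        to-start : ∀ {v} → A v → SameComponent G A v (centre-at y 0)
        to-start v∈ with separator-centre (⊆x v∈)
        ... | k , k≤d , refl = back k k≤d

    connected-separators : ConnectedSeparators decomposition
    connected-separators (inj₁ ch) = chain-connected ch id proj₁
    connected-separators (inj₂ ch) = chain-connected ch (λ (p , q) → q , p) proj₂

-- Displaying presupposes finite separators, and assertion (ii) alone does not provide them: two
-- adjacent leaves may share an infinite set.
theorem2 : (∀ {a} → ExcludedMiddle a) →
    (∀ {a b} → Extensionality a b) →
    ∀ {ℓ : Level} (G : Graph ℓ) → Connected G →
    (U : Pred (Graph.V G) ℓ) →
    ExactlyOneOf
    (∃ λ (K : Comb G) → AttachedTo G U K)
    (∃ λ (D : TreeDecomposition G) → RaylessWithFiniteParts D U)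
    × (∀ (D : TreeDecomposition G) → RaylessWithFiniteParts D U →
    FiniteSeparators D → Displays D (∂Ω G U))
    × ((∃ λ (D : TreeDecomposition G) → RaylessWithFiniteParts D U) →
    ∃ λ (D : TreeDecomposition G) →
    RaylessWithFiniteParts D U × Displays D (∂Ω G U) × ConnectedSeparators D)
theorem2 em ext G connected U = exactly-one , displays , connected-choice
  where
  open Construction em ext connected U using (module WithoutComb)
  displays : ∀ D → RaylessWithFiniteParts D U → FiniteSeparators D → Displays D (∂Ω G U)
  displays D = Decomposition.displays em D ext
  excludes : (∃ λ D → RaylessWithFiniteParts D U) → ¬ ∃ λ K → AttachedTo G U K
  excludes (D , R) (K , K-U) = Decomposition.no-comb em D R K K-U
  exactly-one : ExactlyOneOf (∃ λ K → AttachedTo G U K) (∃ λ D → RaylessWithFiniteParts D U)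
  exactly-one with em {P = ∃ λ K → AttachedTo G U K}
  ... | yes comb   = inj₁ (comb , λ D → excludes D comb)
  ... | no no-comb = let open WithoutComb no-comb in
    inj₂ (no-comb , decomposition , rayless-with-finite-parts)
  connected-choice : (∃ λ D → RaylessWithFiniteParts D U) →
    ∃ λ D → RaylessWithFiniteParts D U × Displays D (∂Ω G U) × ConnectedSeparators D
  -- The given decomposition serves to exclude combs; the exploration then supplies the one with
  -- connected separators.
  connected-choice D = let open WithoutComb (excludes D) in
    decomposition , rayless-with-finite-parts ,
    displays decomposition rayless-with-finite-parts finite-separators , connected-separators
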